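{- Let $k\ge 1$ be an integer, and suppose that every finite simple $K_{k+1}$-minor-free graph is $k$-colorable (i.e. has a proper vertex coloring with at most $k$ colors). Then every finite simple $K_{k+1}$-minor-free graph $G$ satisfies $\chi_{\rm o}(G)\le 2k-1$.
   Context: All graphs are finite and simple. $N_G(v)$ denotes the open neighborhood of $v$ in $G$. A graph $H$ is a minor of $G$ if $H$ can be obtained from $G$ by deleting edges and/or vertices and contracting edges; $G$ is $H$-minor-free if $H$ is not a minor of $G$. An odd coloring of $G$ is a proper vertex coloring in which, for every nonisolated vertex $v$, some color occurs an odd number of times in $N_G(v)$. $\chi_{\rm o}(G)$ is the minimum number of colors in an odd coloring of $G$. -}

module Defs where

open import Level using (0ℓ)
open import Data.Empty using (⊥-elim)
open import Data.Fin using (Fin; zero; suc; punchIn; punchOut; finToFun; funToFin)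
open import Data.Fin.Properties using (_≟_; any?; all?; finToFun-funToFin)
open import Data.Fin.Permutation using (Permutation; _⟨$⟩ʳ_)
open import Data.List using (List; []; _∷_; allFin; filter; length; map)
open import Data.List.Properties using (filter-≐; filter-none; map-tabulate)
open import Data.List.Relation.Unary.All.Properties using (tabulate⁺)
open import Data.Nat using (ℕ; zero; suc; _≤_; z≤n; s≤s; parity)
open import Data.Parity using (1ℙ)
import Data.Parity.Properties as Parity
open import Data.Product using (_×_; _,_; proj₁; proj₂; ∃-syntax)
open import Data.Sum using (_⊎_; inj₁; inj₂)
open import Function using (_∘_)
open import Function.Bundles using (_⇔_)
open import Relation.Binary using (Rel; Symmetric; Decidable)
open import Relation.Binary.PropositionalEquality
  using (_≡_; _≢_; _≗_; refl; sym; trans; cong; subst)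
open import Relation.Nullary using (¬_; Dec; yes; no; ¬?; _×-dec_; _⊎-dec_; _→-dec_; map′)
open import Relation.Unary using (Pred) renaming (Decidable to Decidable₁)

infix 4 _≅_ _≼_

record Graph (n : ℕ) : Set₁ where
  field
    Adj     : Rel (Fin n) 0ℓ
    adj?    : Decidable Adj
    adj-sym : Symmetric Adj
    adj-irr : ∀ {v} → ¬ Adj v v

open Graph

K : (n : ℕ) → Graph n
K n = record
  { Adj     = _≢_
  ; adj?    = λ u v → ¬? (u ≟ v)
  ; adj-sym = λ u≢v v≡u → u≢v (sym v≡u)
  ; adj-irr = λ v≢v → v≢v refl
  }

record _≅_ {m n : ℕ} (G : Graph m) (H : Graph n) : Set where
  field
    bijection : Permutation m n
    preserves : ∀ u v → Adj G u v ⇔ Adj H (bijection ⟨$⟩ʳ u) (bijection ⟨$⟩ʳ v)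

SameEnds : {n : ℕ} → (u v x y : Fin n) → Set
SameEnds u v x y = (x ≡ u × y ≡ v) ⊎ (x ≡ v × y ≡ u)

deleteEdge : {n : ℕ} → Graph n → (u v : Fin n) → Graph n
deleteEdge G u v = record
  { Adj     = λ x y → Adj G x y × ¬ SameEnds u v x y
  ; adj?    = λ x y → adj? G x y
              ×-dec ¬? ((x ≟ u ×-dec y ≟ v) ⊎-dec (x ≟ v ×-dec y ≟ u))
  ; adj-sym = λ (x~y , ≠uv) → adj-sym G x~y , λ where
      (inj₁ (y≡u , x≡v)) → ≠uv (inj₂ (x≡v , y≡u))
      (inj₂ (y≡v , x≡u)) → ≠uv (inj₁ (x≡u , y≡v))
  ; adj-irr = λ (v~v , _) → adj-irr G v~v
  }

-- punchIn v enumerates the vertices other than v.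
deleteVertex : {n : ℕ} → Graph (suc n) → Fin (suc n) → Graph n
deleteVertex G v = record
  { Adj     = λ x y → Adj G (punchIn v x) (punchIn v y)
  ; adj?    = λ x y → adj? G (punchIn v x) (punchIn v y)
  ; adj-sym = adj-sym G
  ; adj-irr = adj-irr G
  }

-- The quotient map identifying v with u; the remaining vertices are
-- renumbered as in deleteVertex.
merge : {n : ℕ} {u v : Fin (suc n)} → v ≢ u → Fin (suc n) → Fin n
merge {v = v} v≢u x with v ≟ x
... | yes _   = punchOut v≢u
... | no  v≢x = punchOut v≢x

edge⇒≢ : {n : ℕ} (G : Graph n) {u v : Fin n} → Adj G u v → v ≢ u
edge⇒≢ G u~v refl = adj-irr G u~v

-- The result is simple: loops are dropped by i ≢ j, and parallel edges
-- coincide because adjacency is a relation.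
contract : {n : ℕ} (G : Graph (suc n)) {u v : Fin (suc n)} → Adj G u v → Graph n
contract G u~v = record
  { Adj     = λ i j → i ≢ j × ∃[ x ] ∃[ y ] (π x ≡ i × π y ≡ j × Adj G x y)
  ; adj?    = λ i j → ¬? (i ≟ j) ×-dec
              any? λ x → any? λ y → (π x ≟ i) ×-dec (π y ≟ j) ×-dec adj? G x y
  ; adj-sym = λ (i≢j , x , y , πx≡i , πy≡j , x~y) →
              (λ j≡i → i≢j (sym j≡i)) , y , x , πy≡j , πx≡i , adj-sym G x~y
  ; adj-irr = λ (v≢v , _) → v≢v refl
  }
  where π = merge (edge⇒≢ G u~v)

-- H ≼ G: H is a minor of G.
data _≼_ {m : ℕ} (H : Graph m) : {n : ℕ} → Graph n → Set₁ where
  done      : H ≼ H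
  relabel   : ∀ {n n′} {G : Graph n} {G′ : Graph n′} → G ≅ G′ → H ≼ G′ → H ≼ G
  del-edge  : ∀ {n} {G : Graph n} {u v} → Adj G u v → H ≼ deleteEdge G u v → H ≼ G
  del-vert  : ∀ {n} {G : Graph (suc n)} v → H ≼ deleteVertex G v → H ≼ G
  contr     : ∀ {n} {G : Graph (suc n)} {u v} (e : Adj G u v) → H ≼ contract G e → H ≼ G

_MinorFree_ : {m n : ℕ} → Graph m → Graph n → Set₁
H MinorFree G = ¬ (H ≼ G)

Proper : {n m : ℕ} → Graph n → (Fin n → Fin m) → Set
Proper G f = ∀ u v → Adj G u v → f u ≢ f v

-- Colors need not all be used, so this says "with at most m colors".
Colorable : {n : ℕ} → Graph n → ℕ → Set
Colorable {n} G m = ∃[ f ] Proper {n} {m} G f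

occurrences : {n m : ℕ} → Graph n → (Fin n → Fin m) → Fin n → Fin m → ℕ
occurrences {n} G f v c = length (filter (λ u → adj? G v u ×-dec (f u ≟ c)) (allFin n))

Odd : ℕ → Set
Odd n = parity n ≡ 1ℙ

NonIsolated : {n : ℕ} → Graph n → Fin n → Set
NonIsolated G v = ∃[ u ] Adj G v u

IsOddColoring : {n m : ℕ} → Graph n → (Fin n → Fin m) → Set
IsOddColoring G f =
  Proper G f × (∀ v → NonIsolated G v → ∃[ c ] Odd (occurrences G f v c))

OddColorable : {n : ℕ} → Graph n → ℕ → Set
OddColorable {n} G m = ∃[ f ] IsOddColoring {n} {m} G f

------------------------------------------------------------------------
-- The least m with OddColorable G m exists, because the property is
-- decidable and giving all vertices distinct colors is an odd coloring.

module _ {n m : ℕ} (G : Graph n) where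

  isOddColoring? : (f : Fin n → Fin m) → Dec (IsOddColoring G f)
  isOddColoring? f =
    (all? λ u → all? λ v → adj? G u v →-dec ¬? (f u ≟ f v))
    ×-dec
    (all? λ v → any? (adj? G v) →-dec
      any? λ c → parity (occurrences G f v c) Parity.≟ 1ℙ)

  occurrences-cong : {f g : Fin n → Fin m} → f ≗ g →
                     ∀ v c → occurrences G f v c ≡ occurrences G g v c
  occurrences-cong f≗g v c = cong length (filter-≐ _ _
    ( (λ {u} (a , fu≡c) → a , trans (sym (f≗g u)) fu≡c)
    , (λ {u} (a , gu≡c) → a , trans (f≗g u) gu≡c)) (allFin n))

  isOddColoring-cong : {f g : Fin n → Fin m} → f ≗ g →
                       IsOddColoring G f → IsOddColoring G g
  isOddColoring-cong f≗g (proper , odd) =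
      (λ u v u~v gu≡gv →
        proper u v u~v (trans (f≗g u) (trans gu≡gv (sym (f≗g v)))))
    , (λ v nonIso → let c , o = odd v nonIso in
        c , subst Odd (occurrences-cong f≗g v c) o)

oddColorable? : {n : ℕ} (G : Graph n) → Decidable₁ (OddColorable G)
oddColorable? {n} G m = map′
  (λ (i , p) → finToFun i , p)
  (λ (f , p) → funToFin f , isOddColoring-cong G (λ x → sym (finToFun-funToFin f x)) p)
  (any? λ (i : Fin _) → isOddColoring? G (finToFun {m} {n} i))

length-filter-≟ : {n : ℕ} (c : Fin n) → length (filter (_≟ c) (allFin n)) ≡ 1
length-filter-≟ {suc n} zero =
  cong (suc ∘ length) (filter-none (_≟ zero) (tabulate⁺ {n = n} {f = suc} λ _ ()))
length-filter-≟ {suc n} (suc c) =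
  trans (cong (length ∘ filter (_≟ suc c)) (sym (map-tabulate (λ i → i) suc)))
        (trans (shift (allFin n)) (length-filter-≟ c))
  where
  shift : ∀ xs → length (filter (_≟ suc c) (map suc xs)) ≡ length (filter (_≟ c) xs)
  shift []       = refl
  shift (x ∷ xs) with x ≟ c
  ... | yes _ = cong suc (shift xs)
  ... | no  _ = shift xs

oddColorable-order : {n : ℕ} (G : Graph n) → OddColorable G n
oddColorable-order {n} G = (λ v → v) , (λ u v u~v u≡v → edge⇒≢ G u~v (sym u≡v)) , λ v (c , v~c) →
  c , cong parity (trans
    (cong length (filter-≐ _ (_≟ c) (proj₂ , λ { refl → v~c , refl }) (allFin n)))
    (length-filter-≟ c))

least : {P : Pred ℕ 0ℓ} → Decidable₁ P → ∀ {b} → P b →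
        ∃[ m ] (P m × (∀ l → P l → m ≤ l))
least P? {zero} p = 0 , p , λ _ _ → z≤n
least {P} P? {suc b} p with P? 0
... | yes p₀ = 0 , p₀ , λ _ _ → z≤n
... | no ¬p₀ with least {P ∘ suc} (P? ∘ suc) {b} p
...   | m , pm , min = suc m , pm , λ where
        zero    p₀ → ⊥-elim (¬p₀ p₀)
        (suc l) pl → s≤s (min l pl)

χₒ-least : {n : ℕ} (G : Graph n) →
           ∃[ m ] (OddColorable G m × (∀ l → OddColorable G l → m ≤ l))
χₒ-least G = least (oddColorable? G) (oddColorable-order G)

χₒ : {n : ℕ} → Graph n → ℕ
χₒ G = proj₁ (χₒ-least G)

{-# OPTIONS --safe #-}

-- Write k = m + 2.  It suffices to find an independent set X and a colouring
-- of X with k - 1 colours such that every vertex outside X sees some colour of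
-- X an odd number of times.  Indeed, contract every non-isolated x ∈ X to a
-- neighbour and colour the resulting minor with k further colours: this colours
-- the complement of X properly, and the chosen neighbour of x is the only
-- neighbour of x with its colour.
--
-- Such an X exists by induction on k.  In a connected graph, pick vertices one
-- at a time at distance exactly 3 from the earlier ones.  Their closed
-- neighbourhoods are disjoint with connected union B, and when no further
-- choice is possible B dominates the graph.  The picked vertices get one
-- colour, which every other vertex of B sees exactly once; the rest has no
-- K k minor, because B would extend it to a K (k + 1) minor.  For k = 2 the
-- graph is a forest, where an independent set X realising any prescribed
-- parities of |N(v) ∩ X| for v ∉ X is built by removing leaves.

module Submission where

open import Defs
open import Data.Nat using (ℕ; zero; suc; _+_; _*_; _∸_; _≤_; _≥_; parity)
open import Data.Nat.Properties using (+-suc; +-identityʳ)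
open import Data.Empty using (⊥-elim)
open import Data.Fin using (Fin; zero; suc; punchIn; punchOut; splitAt; join)
open import Data.Fin.Permutation using (permutation)
open import Data.Fin.Properties
  using (_≟_; any?; punchIn-punchOut; punchOut-punchIn; punchInᵢ≢i; punchOut-cong; splitAt-join)
open import Data.Fin.Subset using (Subset; _∈_; _∉_; _⊆_; _⊂_; _⊃_; ⊤; ⊥; ⁅_⁆)
open import Data.Fin.Subset.Induction using (Acc; acc; ⊂-wellFounded; ⊃-wellFounded)
open import Data.Fin.Subset.Properties using (_∈?_; ∉⊥; ∈⊤; nonempty?; x∈⁅x⁆; x∈⁅y⁆⇒x≡y)
open import Data.List using ([]; _∷_; allFin; filter; length)
open import Data.List.Properties using (filter-≐)
open import Data.Maybe using (Maybe; just; nothing)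
import Data.Maybe as Maybe
open import Data.Maybe.Properties using (just-injective; ≡-dec)
open import Data.Parity using (Parity; 0ℙ; 1ℙ; _⁻¹)
import Data.Parity.Properties as Parity
open import Data.Product using (_×_; _,_; proj₁; proj₂; ∃-syntax)
open import Data.Sum using (_⊎_; inj₁; inj₂; [_,_]′)
open import Data.Vec using (tabulate)
open import Data.Vec.Properties using (lookup⇒[]=; []=⇒lookup; lookup∘tabulate)
open import Function using (_∘_; case_of_)
open import Function.Bundles using (mk⇔)
open import Relation.Binary.Construct.Closure.ReflexiveTransitive
  using (Star; ε; _◅_; _◅◅_; kleisliStar)
import Relation.Binary.Construct.Closure.ReflexiveTransitive as Star
open import Relation.Binary.PropositionalEquality
  using (_≡_; _≢_; refl; sym; trans; cong; subst; subst₂)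
open import Relation.Nullary
  using (¬_; yes; no; does; ¬?; _×-dec_; _⊎-dec_; contradiction; decidable-stable)
open import Relation.Nullary.Decidable using (dec-true)
open import Relation.Unary using (Decidable; _≐_)

open Graph

-- Clique minors as labelled branch sets.

merge-punchIn : ∀ {n} {u v : Fin (suc n)} (v≢u : v ≢ u) i → merge v≢u (punchIn v i) ≡ i
merge-punchIn {v = v} v≢u i with v ≟ punchIn v i
... | yes v≡ = contradiction (sym v≡) (punchInᵢ≢i v i)
... | no  v≢ = trans (punchOut-cong v refl) (punchOut-punchIn v)

-- Only `v` changes its representative under `punchIn v` after merging, and its new one, `u`, has
-- the same label. Hence a labelling constant on a contracted edge descends to the contraction.
label-merge : ∀ {n} {L : Set} {u v : Fin (suc n)} (v≢u : v ≢ u) (μ : Fin (suc n) → L) →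
              μ u ≡ μ v → ∀ x → μ (punchIn v (merge v≢u x)) ≡ μ x
label-merge {v = v} v≢u μ μu≡μv x with v ≟ x
... | yes refl = trans (cong μ (punchIn-punchOut v≢u)) μu≡μv
... | no  v≢x  = cong μ (punchIn-punchOut v≢x)

-- Delete vertices outside the image of `e` until none is left. Then `e` is a bijection: two indices
-- with one image would put a loop there, so injectivity follows from adjacency.
clique⇒minor : ∀ {n m} (G : Graph n) (e : Fin m → Fin n) →
               (∀ {i j} → i ≢ j → Adj G (e i) (e j)) → K m ≼ G
clique⇒minor {zero} {zero} G e e-adj =
  relabel (record { bijection = permutation (λ ()) (λ ()) (λ ()) (λ ())
                  ; preserves = λ () }) done
clique⇒minor {zero} {suc m} G e e-adj with () ← e zero
clique⇒minor {suc n} {m} G e e-adj with any? (λ v → ¬? (any? λ i → v ≟ e i))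
... | yes (v , v∉) =
      del-vert v (clique⇒minor (deleteVertex G v) (λ i → punchOut (v≢e i)) λ {i} {j} i≢j →
        subst₂ (Adj G) (sym (punchIn-punchOut (v≢e i))) (sym (punchIn-punchOut (v≢e j)))
          (e-adj i≢j))
  where
  v≢e : ∀ i → v ≢ e i
  v≢e i v≡ei = v∉ (i , v≡ei)
... | no onto = relabel (record { bijection = permutation e⁻¹ e left right
                                ; preserves = λ u v → mk⇔ (to u v) (from u v) }) done
  where
  hit : ∀ v → ∃[ i ] v ≡ e i
  hit v with any? (λ i → v ≟ e i)
  ... | yes h = h
  ... | no ¬h = contradiction (v , ¬h) onto
  e⁻¹ : Fin (suc n) → Fin m
  e⁻¹ v = proj₁ (hit v)
  right : ∀ v → e (e⁻¹ v) ≡ v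
  right v = sym (proj₂ (hit v))
  left : ∀ i → e⁻¹ (e i) ≡ i
  left i with e⁻¹ (e i) ≟ i
  ... | yes p = p
  ... | no ¬p = contradiction (subst (λ x → Adj G x (e i)) (right (e i)) (e-adj ¬p)) (adj-irr G)
  to : ∀ u v → Adj G u v → e⁻¹ u ≢ e⁻¹ v
  to u v u~v eq = edge⇒≢ G u~v (trans (sym (right v)) (trans (cong e (sym eq)) (right u)))
  from : ∀ u v → e⁻¹ u ≢ e⁻¹ v → Adj G u v
  from u v ne = subst₂ (Adj G) (right u) (right v) (e-adj ne)

Within : ∀ {n m} → Graph n → (Fin n → Maybe (Fin m)) → Fin m → Fin n → Fin n → Set
Within G μ i u v = Adj G u v × μ u ≡ just i × μ v ≡ just i

-- A K m minor inside S: the branch sets are the fibres of label over just i.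
record CliqueModel {n} (G : Graph n) (S : Subset n) (m : ℕ) : Set where
  field
    label      : Fin n → Maybe (Fin m)
    label-∈    : ∀ {v i} → label v ≡ just i → v ∈ S
    root       : Fin m → Fin n
    label-root : ∀ i → label (root i) ≡ just i
    connected  : ∀ {v i} → label v ≡ just i → Star (Within G label i) (root i) v
    adjacent   : ∀ {i j} → i ≢ j → ∃[ u ] ∃[ v ] (label u ≡ just i × label v ≡ just j × Adj G u v)

open CliqueModel

model-⊆ : ∀ {n m} {G : Graph n} {S T : Subset n} → S ⊆ T → CliqueModel G S m → CliqueModel G T m
model-⊆ S⊆T M = record
  { label = label M ; label-∈ = λ eq → S⊆T (label-∈ M eq) ; root = root M
  ; label-root = label-root M ; connected = connected M ; adjacent = adjacent M }

contractModel : ∀ {n m} {G : Graph (suc n)} {u v i} (u~v : Adj G u v) (M : CliqueModel G ⊤ m) →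
                label M u ≡ just i → label M v ≡ just i →
                CliqueModel (contract G u~v) ⊤ m
contractModel {G = G} {u} {v} u~v M lu lv = record
  { label      = μ
  ; label-∈    = λ _ → ∈⊤
  ; root       = π ∘ root M
  ; label-root = λ i → trans (μπ _) (label-root M i)
  ; connected  = λ {x} {i} eq → subst (Star _ _) (merge-punchIn v≢u x)
                   (kleisliStar π step (connected M eq))
  ; adjacent   = λ i≢j → let x , y , lx , ly , x~y = adjacent M i≢j in
      π x , π y , trans (μπ x) lx , trans (μπ y) ly
      , (λ eq → i≢j (just-injective
          (trans (sym lx) (trans (sym (μπ x)) (trans (cong μ eq) (trans (μπ y) ly))))))
      , x , y , refl , refl , x~y
  }
  where
  v≢u = edge⇒≢ G u~v
  π = merge v≢u
  μ = label M ∘ punchIn v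
  μπ = label-merge v≢u (label M) (trans lu (sym lv))
  step : ∀ {i x y} → Within G (label M) i x y →
         Star (Within (contract G u~v) μ i) (π x) (π y)
  step {i} {x} {y} (x~y , lx , ly) with π x ≟ π y
  -- An edge whose ends are merged becomes an empty walk.
  ... | yes eq = subst (Star _ (π x)) eq ε
  ... | no  ne = ((ne , x , y , refl , refl , x~y) , trans (μπ x) lx , trans (μπ y) ly) ◅ ε

-- Contract edges inside branch sets while there are any. Afterwards a walk inside a branch set has
-- no edge, so each branch set is just its root and the roots form a clique.
model⇒minor : ∀ {n m} (G : Graph n) → CliqueModel G ⊤ m → K m ≼ G
model⇒minor {n} {m} G M with any? (λ u → any? λ v → any? λ i →
  adj? G u v ×-dec ≡-dec _≟_ (label M u) (just i) ×-dec ≡-dec _≟_ (label M v) (just i))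
model⇒minor {zero}  G M | yes (() , _)
model⇒minor {suc n} G M | yes (u , v , i , u~v , lu , lv) =
  contr u~v (model⇒minor (contract G u~v) (contractModel u~v M lu lv))
... | no ¬e = clique⇒minor G (root M) λ i≢j →
      let u , v , lu , lv , u~v = adjacent M i≢j in
      subst₂ (Adj G) (sym (single (connected M lu))) (sym (single (connected M lv))) u~v
  where
  single : ∀ {i u v} → Star (Within G (label M) i) u v → u ≡ v
  single ε = refl
  single ((u~w , lu , lw) ◅ _) = contradiction (_ , _ , _ , u~w , lu , lw) ¬e

-- Decidable subsets, counting and parity.

module _ {n : ℕ} {P : Fin n → Set} (P? : Decidable P) where

  subset : Subset n
  subset = tabulate (does ∘ P?)

  ∈-subset⁺ : ∀ {v} → P v → v ∈ subset
  ∈-subset⁺ {v} p = lookup⇒[]= v subset (trans (lookup∘tabulate _ v) (dec-true (P? v) p))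

  ∈-subset⁻ : ∀ {v} → v ∈ subset → P v
  ∈-subset⁻ {v} v∈ with P? v | trans (sym (lookup∘tabulate (does ∘ P?) v)) ([]=⇒lookup v∈)
  ... | yes p | _ = p

  # : ℕ
  # = length (filter P? (allFin n))

module _ {n : ℕ} {P Q : Fin n → Set} (P? : Decidable P) (Q? : Decidable Q) where

  #-cong : P ≐ Q → # P? ≡ # Q?
  #-cong P≐Q = cong length (filter-≐ P? Q? P≐Q (allFin n))

  #-⊎ : ∀ {R} (R? : Decidable R) → (∀ {v} → P v → ¬ Q v) → R ≐ (λ v → P v ⊎ Q v) →
        # R? ≡ # P? + # Q?
  #-⊎ R? disj (to , from) = go (allFin n)
    where
    go : ∀ vs → length (filter R? vs) ≡ length (filter P? vs) + length (filter Q? vs)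
    go [] = refl
    go (v ∷ vs) with R? v | P? v | Q? v
    ... | _     | yes p | yes q = contradiction q (disj p)
    ... | no ¬r | yes p | _     = contradiction (from (inj₁ p)) ¬r
    ... | no ¬r | _     | yes q = contradiction (from (inj₂ q)) ¬r
    ... | yes r | no ¬p | no ¬q = contradiction (to r) [ ¬p , ¬q ]′
    ... | no _  | no _  | no _  = go vs
    ... | yes _ | yes _ | no _  = cong suc (go vs)
    ... | yes _ | no _  | yes _ = trans (cong suc (go vs)) (sym (+-suc _ _))

#-unique : ∀ {n} {P : Fin n → Set} (P? : Decidable P) {r} →
           P r → (∀ {v} → P v → v ≡ r) → # P? ≡ 1
#-unique P? {r} pr uniq =
  trans (#-cong P? (_≟ r) (uniq , λ { refl → pr })) (length-filter-≟ r)

#-none : ∀ {n} {P : Fin n → Set} (P? : Decidable P) → (∀ {v} → ¬ P v) → # P? ≡ 0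
#-none {n} P? none = go (allFin n)
  where
  go : ∀ vs → length (filter P? vs) ≡ 0
  go [] = refl
  go (v ∷ vs) with P? v
  ... | yes p = contradiction p none
  ... | no _  = go vs

parity-suc : ∀ m → parity (suc m) ≡ parity m ⁻¹
parity-suc zero = refl
parity-suc (suc zero) = refl
parity-suc (suc (suc m)) = parity-suc m

module _ {n : ℕ} (S : Subset n) (v : Fin n) where

  without? : Decidable (λ u → u ∈ S × u ≢ v)
  without? u = u ∈? S ×-dec ¬? (u ≟ v)

  adjoin? : Decidable (λ u → u ∈ S ⊎ u ≡ v)
  adjoin? u = u ∈? S ⊎-dec u ≟ v

  infixl 6 _without_ _adjoin_

  _without_ : Subset n
  _without_ = subset without?

  _adjoin_ : Subset n
  _adjoin_ = subset adjoin?

module _ {n : ℕ} {S : Subset n} {v : Fin n} where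

  ∈-without⁺ : ∀ {u} → u ∈ S → u ≢ v → u ∈ S without v
  ∈-without⁺ u∈S u≢v = ∈-subset⁺ (without? S v) (u∈S , u≢v)

  ∈-without⁻ : ∀ {u} → u ∈ S without v → u ∈ S × u ≢ v
  ∈-without⁻ = ∈-subset⁻ (without? S v)

  without-⊂ : v ∈ S → S without v ⊂ S
  without-⊂ v∈S = (proj₁ ∘ ∈-without⁻) , v , v∈S , λ v∈ → proj₂ (∈-without⁻ v∈) refl

  ∈-adjoin⁺ : ∀ {u} → u ∈ S ⊎ u ≡ v → u ∈ S adjoin v
  ∈-adjoin⁺ = ∈-subset⁺ (adjoin? S v)

  ∈-adjoin⁻ : ∀ {u} → u ∈ S adjoin v → u ∈ S ⊎ u ≡ v
  ∈-adjoin⁻ = ∈-subset⁻ (adjoin? S v)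

  ⊂-adjoin : v ∉ S → S ⊂ S adjoin v
  ⊂-adjoin v∉S = (∈-adjoin⁺ ∘ inj₁) , v , ∈-adjoin⁺ (inj₂ refl) , v∉S

-- Connected sets and extension of clique models.

module _ {n : ℕ} (G : Graph n) where

  Inside : Subset n → Fin n → Fin n → Set
  Inside F u v = Adj G u v × u ∈ F × v ∈ F

  record ConnectedFrom (r : Fin n) (F : Subset n) : Set where
    field
      root-∈ : r ∈ F
      reach  : ∀ {v} → v ∈ F → Star (Inside F) r v

  open ConnectedFrom public

  emptyModel : CliqueModel G ⊥ 0
  emptyModel = record
    { label = λ _ → nothing ; label-∈ = λ () ; root = λ () ; label-root = λ ()
    ; connected = λ () ; adjacent = λ { {()} } }

  connectedFrom-⁅⁆ : ∀ r → ConnectedFrom r ⁅ r ⁆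
  connectedFrom-⁅⁆ r = record
    { root-∈ = x∈⁅x⁆ r
    ; reach = λ v∈ → subst (Star _ r) (sym (x∈⁅y⁆⇒x≡y r v∈)) ε }

  -- `F` becomes the branch set numbered zero. It is adjacent to every other one because it
  -- dominates `R`, in particular the root of each branch set of the given model.
  extendModel : ∀ {m r F R S} → ConnectedFrom r F → F ⊆ S → R ⊆ S →
                (∀ {v} → v ∈ R → v ∉ F × ∃[ f ] (f ∈ F × Adj G f v)) →
                CliqueModel G R m → CliqueModel G S (suc m)
  extendModel {m} {r} {F} {R} {S} F-conn F⊆S R⊆S dom M = record
    { label = lab ; label-∈ = lab-∈ ; root = rt ; label-root = lab-root
    ; connected = conn ; adjacent = adj }
    where
    lab : Fin n → Maybe (Fin (suc m))
    lab v with v ∈? F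
    ... | yes _ = just zero
    ... | no  _ = Maybe.map suc (label M v)
    lab-F : ∀ {v} → v ∈ F → lab v ≡ just zero
    lab-F {v} v∈F with v ∈? F
    ... | yes _  = refl
    ... | no v∉F = contradiction v∈F v∉F
    lab-M : ∀ {v i} → label M v ≡ just i → lab v ≡ just (suc i)
    lab-M {v} eq with v ∈? F
    ... | yes v∈F = contradiction v∈F (proj₁ (dom (label-∈ M eq)))
    ... | no  _   = cong (Maybe.map suc) eq
    lab⁻ : ∀ {v i} → lab v ≡ just i →
           (v ∈ F × i ≡ zero) ⊎ ∃[ j ] (label M v ≡ just j × i ≡ suc j)
    lab⁻ {v} eq with v ∈? F | eq
    ... | yes v∈F | refl = inj₁ (v∈F , refl)
    ... | no  _   | eq′ with label M v | eq′
    ...   | just j | refl = inj₂ (j , refl , refl)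
    lab-∈ : ∀ {v i} → lab v ≡ just i → v ∈ S
    lab-∈ {v} eq with lab⁻ {v} eq
    ... | inj₁ (v∈F , _) = F⊆S v∈F
    ... | inj₂ (_ , eq′ , _) = R⊆S (label-∈ M eq′)
    rt : Fin (suc m) → Fin n
    rt zero = r
    rt (suc i) = root M i
    lab-root : ∀ i → lab (rt i) ≡ just i
    lab-root zero = lab-F (root-∈ F-conn)
    lab-root (suc i) = lab-M (label-root M i)
    conn : ∀ {v i} → lab v ≡ just i → Star (Within G lab i) (rt i) v
    conn {v} eq with lab⁻ {v} eq
    ... | inj₁ (v∈F , refl) =
      Star.map (λ (a , x∈ , y∈) → a , lab-F x∈ , lab-F y∈) (reach F-conn v∈F)
    ... | inj₂ (_ , eq′ , refl) =
      Star.map (λ (a , lx , ly) → a , lab-M lx , lab-M ly) (connected M eq′)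
    adj : ∀ {i j} → i ≢ j → ∃[ u ] ∃[ v ] (lab u ≡ just i × lab v ≡ just j × Adj G u v)
    adj {zero} {zero} ne = contradiction refl ne
    adj {zero} {suc j} _ =
      let _ , f , f∈F , a = dom (label-∈ M (label-root M j)) in
      f , root M j , lab-F f∈F , lab-M (label-root M j) , a
    adj {suc i} {zero} _ =
      let _ , f , f∈F , a = dom (label-∈ M (label-root M i)) in
      root M i , f , lab-M (label-root M i) , lab-F f∈F , adj-sym G a
    adj {suc i} {suc j} ne =
      let u , v , lu , lv , a = adjacent M (ne ∘ cong suc) in u , v , lab-M lu , lab-M lv , a

  edgeModel : ∀ {S u v} → u ∈ S → v ∈ S → Adj G u v → CliqueModel G S 2
  edgeModel {S} {u} {v} u∈S v∈S u~v =
    extendModel (connectedFrom-⁅⁆ u) (single u∈S) (single v∈S)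
      (λ x∈ → (λ x∈′ → edge⇒≢ G u~v (trans (sym (x∈⁅y⁆⇒x≡y v x∈)) (x∈⁅y⁆⇒x≡y u x∈′)))
             , u , x∈⁅x⁆ u , subst (Adj G u) (sym (x∈⁅y⁆⇒x≡y v x∈)) u~v)
      (extendModel (connectedFrom-⁅⁆ v) (λ x∈ → x∈) (⊥-elim ∘ ∉⊥) (⊥-elim ∘ ∉⊥) emptyModel)
    where
    single : ∀ {w} → w ∈ S → ⁅ w ⁆ ⊆ S
    single {w} w∈S x∈ = subst (_∈ S) (sym (x∈⁅y⁆⇒x≡y w x∈)) w∈S

  -- Leaves of forests.

  data Leaf (S : Subset n) (ℓ : Fin n) : Set where
    isolated : (∀ {u} → u ∈ S → ¬ Adj G ℓ u) → Leaf S ℓ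
    pendant  : ∀ {p} → p ∈ S → Adj G ℓ p → (∀ {u} → u ∈ S → Adj G ℓ u → u ≡ p) → Leaf S ℓ

  -- In walk, p and v are the last two vertices of a path whose earlier vertices
  -- form F; a neighbour of v in F closes a cycle.
  leaf : ∀ {S r} → ¬ CliqueModel G S 3 → r ∈ S → ∃[ ℓ ] (ℓ ∈ S × Leaf S ℓ)
  leaf {S} {r} free r∈S with any? (λ p → p ∈? S ×-dec adj? G r p)
  ... | no none = r , r∈S , isolated λ u∈S r~u → none (_ , u∈S , r~u)
  ... | yes (p , p∈S , r~p) with any? (λ v → v ∈? S ×-dec adj? G p v ×-dec ¬? (v ≟ r))
  ...   | no none = p , p∈S , pendant r∈S (adj-sym G r~p) λ {u} u∈S p~u →
          decidable-stable (u ≟ r) λ u≢r → none (u , u∈S , p~u , u≢r)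
  ...   | yes (v , v∈S , p~v , v≢r) =
          walk (⊃-wellFounded _) (connectedFrom-⁅⁆ r)
            (λ x∈ → subst (_∈ S) (sym (x∈⁅y⁆⇒x≡y r x∈)) r∈S) p∈S v∈S
            (edge⇒≢ G r~p ∘ x∈⁅y⁆⇒x≡y r) (v≢r ∘ x∈⁅y⁆⇒x≡y r) (r , x∈⁅x⁆ r , r~p) p~v
    where
    walk : ∀ {F p v} → Acc _⊃_ F → ConnectedFrom r F → F ⊆ S → p ∈ S → v ∈ S → p ∉ F → v ∉ F →
           ∃[ f ] (f ∈ F × Adj G f p) → Adj G p v → ∃[ ℓ ] (ℓ ∈ S × Leaf S ℓ)
    walk {F} {p} {v} (acc rs) conn F⊆S p∈S v∈S p∉F v∉F (f , f∈F , f~p) p~v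
      with any? (λ u → u ∈? S ×-dec adj? G v u ×-dec ¬? (u ≟ p))
    ... | no none = v , v∈S , pendant p∈S (adj-sym G p~v) λ {u} u∈S v~u →
            decidable-stable (u ≟ p) λ u≢p → none (u , u∈S , v~u , u≢p)
    ... | yes (u , u∈S , v~u , u≢p) with u ∈? F
    -- `F`, `p` and `v` give three pairwise adjacent branch sets: `f` joins `F` to `p`, and `u`
    -- joins `F` to `v`.
    ...   | yes u∈F = contradiction
              (extendModel {R = ⁅ p ⁆ adjoin v} conn F⊆S pv⊆S dom (edgeModel p∈ v∈ p~v)) free
      where
      p∈ : p ∈ ⁅ p ⁆ adjoin v
      p∈ = ∈-adjoin⁺ (inj₁ (x∈⁅x⁆ p))
      v∈ : v ∈ ⁅ p ⁆ adjoin v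
      v∈ = ∈-adjoin⁺ (inj₂ refl)
      pv : ∀ {x} → x ∈ ⁅ p ⁆ adjoin v → x ≡ p ⊎ x ≡ v
      pv = [ inj₁ ∘ x∈⁅y⁆⇒x≡y p , inj₂ ]′ ∘ ∈-adjoin⁻
      pv⊆S : ⁅ p ⁆ adjoin v ⊆ S
      pv⊆S x∈ with pv x∈
      ... | inj₁ refl = p∈S
      ... | inj₂ refl = v∈S
      dom : ∀ {x} → x ∈ ⁅ p ⁆ adjoin v → x ∉ F × ∃[ f ] (f ∈ F × Adj G f x)
      dom x∈ with pv x∈
      ... | inj₁ refl = p∉F , f , f∈F , f~p
      ... | inj₂ refl = v∉F , u , u∈F , adj-sym G v~u
    -- The path advances by one vertex; `F` gains `p`, which bounds the length of the walk.
    ...   | no u∉F = walk (rs (⊂-adjoin p∉F)) conn′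
              (λ x∈ → [ F⊆S , (λ { refl → p∈S }) ]′ (∈-adjoin⁻ x∈)) v∈S u∈S
              (λ v∈ → [ v∉F , edge⇒≢ G p~v ]′ (∈-adjoin⁻ v∈))
              (λ u∈ → [ u∉F , u≢p ]′ (∈-adjoin⁻ u∈))
              (p , ∈-adjoin⁺ (inj₂ refl) , p~v) v~u
      where
      lift : ∀ {x y} → Inside F x y → Inside (F adjoin p) x y
      lift (a , x∈ , y∈) = a , ∈-adjoin⁺ (inj₁ x∈) , ∈-adjoin⁺ (inj₁ y∈)
      conn′ : ConnectedFrom r (F adjoin p)
      conn′ = record
        { root-∈ = ∈-adjoin⁺ (inj₁ (root-∈ conn))
        ; reach = λ x∈ → [ Star.map lift ∘ reach conn
                         , (λ { refl → Star.map lift (reach conn f∈F)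
                              ◅◅ ((f~p , ∈-adjoin⁺ (inj₁ f∈F) , ∈-adjoin⁺ (inj₂ refl)) ◅ ε) }) ]′
                         (∈-adjoin⁻ x∈) }

  -- Independent sets with prescribed parities in forests.

  nbr? : ∀ v (X : Subset n) → Decidable (λ u → Adj G v u × u ∈ X)
  nbr? v X u = adj? G v u ×-dec u ∈? X

  module _ {X : Subset n} {ℓ v : Fin n} where

    nbrs-with-nonadj : ¬ Adj G v ℓ → # (nbr? v (X adjoin ℓ)) ≡ # (nbr? v X)
    nbrs-with-nonadj v≁ℓ = #-cong (nbr? v (X adjoin ℓ)) (nbr? v X)
      ( (λ (a , x∈) → a , [ (λ x∈X → x∈X) , (λ { refl → contradiction a v≁ℓ }) ]′ (∈-adjoin⁻ x∈))
      , (λ (a , x∈) → a , ∈-adjoin⁺ (inj₁ x∈)))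

    parity-with-adj : ℓ ∉ X → Adj G v ℓ →
                      parity (# (nbr? v (X adjoin ℓ))) ≡ parity (# (nbr? v X)) ⁻¹
    parity-with-adj ℓ∉X v~ℓ = trans (cong parity eq) (parity-suc (# (nbr? v X)))
      where
      eq : # (nbr? v (X adjoin ℓ)) ≡ suc (# (nbr? v X))
      eq = trans (#-⊎ (_≟ ℓ) (nbr? v X) (nbr? v (X adjoin ℓ)) (λ { refl → ℓ∉X ∘ proj₂ })
             ( (λ (a , x∈) → [ (λ x∈X → inj₂ (a , x∈X)) , inj₁ ]′ (∈-adjoin⁻ x∈))
             , [ (λ { refl → v~ℓ , ∈-adjoin⁺ (inj₂ refl) })
               , (λ (a , x∈) → a , ∈-adjoin⁺ (inj₁ x∈)) ]′))
             (cong (_+ # (nbr? v X)) (length-filter-≟ ℓ))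

  -- The application asks for odd parity everywhere; the target `t` is arbitrary because removing a
  -- leaf can change the demand at its neighbour.
  record ParitySet (S : Subset n) (t : Fin n → Parity) : Set where
    field
      set         : Subset n
      set-⊆       : set ⊆ S
      independent : ∀ {u v} → u ∈ set → v ∈ set → ¬ Adj G u v
      parities    : ∀ {v} → v ∈ S → v ∉ set → parity (# (nbr? v set)) ≡ t v

  open ParitySet

  toggle : Fin n → (Fin n → Parity) → Fin n → Parity
  toggle p t v with v ≟ p
  ... | yes _ = t v ⁻¹
  ... | no  _ = t v

  toggle-at : ∀ p t → toggle p t p ≡ t p ⁻¹
  toggle-at p t with p ≟ p
  ... | yes _ = refl
  ... | no ne = contradiction refl ne

  toggle-off : ∀ {p v} t → v ≢ p → toggle p t v ≡ t v
  toggle-off {p} {v} t v≢p with v ≟ p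
  ... | yes eq = contradiction eq v≢p
  ... | no _   = refl

  module _ {S : Subset n} {ℓ : Fin n} (ℓ∈S : ℓ ∈ S) where

    addLeaf : ∀ {T t} (X : ParitySet T t) (t′ : Fin n → Parity) → T ⊆ S → ℓ ∉ T →
              (∀ {u} → u ∈ set X → ¬ Adj G ℓ u) →
              (∀ {v} → v ∈ S → v ∉ set X → v ≢ ℓ → parity (# (nbr? v (set X adjoin ℓ))) ≡ t′ v) →
              ParitySet S t′
    addLeaf X t′ T⊆S ℓ∉T ℓ≁X par = record
      { set = set X adjoin ℓ
      ; set-⊆ = λ x∈ → [ T⊆S ∘ set-⊆ X , (λ { refl → ℓ∈S }) ]′ (∈-adjoin⁻ x∈)
      ; independent = λ u∈ v∈ → ind (∈-adjoin⁻ u∈) (∈-adjoin⁻ v∈)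
      ; parities = λ v∈S v∉ → par v∈S (v∉ ∘ ∈-adjoin⁺ ∘ inj₁) (v∉ ∘ ∈-adjoin⁺ ∘ inj₂)
      }
      where
      ind : ∀ {u v} → u ∈ set X ⊎ u ≡ ℓ → v ∈ set X ⊎ v ≡ ℓ → ¬ Adj G u v
      ind (inj₁ u∈) (inj₁ v∈) a = independent X u∈ v∈ a
      ind (inj₁ u∈) (inj₂ refl) a = ℓ≁X u∈ (adj-sym G a)
      ind (inj₂ refl) (inj₁ v∈) a = ℓ≁X v∈ a
      ind (inj₂ refl) (inj₂ refl) a = adj-irr G a

    -- An isolated vertex joins the set. This lifts the demand at the vertex itself and alters no
    -- other neighbour count.
    stepIsolated : ∀ {t} → (∀ {u} → u ∈ S → ¬ Adj G ℓ u) →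
                   ParitySet (S without ℓ) t → ParitySet S t
    stepIsolated {t} iso X = addLeaf X t (proj₁ ∘ ∈-without⁻) (λ ℓ∈ → proj₂ (∈-without⁻ ℓ∈) refl)
      (iso ∘ proj₁ ∘ ∈-without⁻ ∘ set-⊆ X)
      λ v∈S v∉X v≢ℓ → trans (cong parity (nbrs-with-nonadj (iso v∈S ∘ adj-sym G)))
                            (parities X (∈-without⁺ v∈S v≢ℓ) v∉X)

    module _ {p : Fin n} (p∈S : p ∈ S) (ℓ~p : Adj G ℓ p)
             (only : ∀ {u} → u ∈ S → Adj G ℓ u → u ≡ p) {t : Fin n → Parity} where

      -- Whether ℓ joins the set is decided by p: ℓ joins iff p does not.  The
      -- toggled parity at p accounts for ℓ joining.
      stepOdd : t ℓ ≡ 1ℙ → ParitySet (S without ℓ) (toggle p t) → ParitySet S t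
      stepOdd tℓ X with p ∈? set X
      ... | yes p∈X = record
        { set = set X
        ; set-⊆ = proj₁ ∘ ∈-without⁻ ∘ set-⊆ X
        ; independent = independent X
        ; parities = par
        }
        where
        par : ∀ {v} → v ∈ S → v ∉ set X → parity (# (nbr? v (set X))) ≡ t v
        par {v} v∈S v∉X with v ≟ ℓ
        ... | yes refl = trans (cong parity (#-unique (nbr? v (set X)) (ℓ~p , p∈X)
                           λ (a , u∈) → only (proj₁ (∈-without⁻ (set-⊆ X u∈))) a)) (sym tℓ)
        ... | no v≢ℓ = trans (parities X (∈-without⁺ v∈S v≢ℓ) v∉X)
                         (toggle-off t λ { refl → v∉X p∈X })
      ... | no p∉X = addLeaf X t (proj₁ ∘ ∈-without⁻) (λ ℓ∈ → proj₂ (∈-without⁻ ℓ∈) refl)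
        (λ u∈ a → p∉X (subst (_∈ set X) (only (proj₁ (∈-without⁻ (set-⊆ X u∈))) a) u∈)) par
        where
        par : ∀ {v} → v ∈ S → v ∉ set X → v ≢ ℓ → parity (# (nbr? v (set X adjoin ℓ))) ≡ t v
        par {v} v∈S v∉X v≢ℓ with v ≟ p
        ... | yes refl = trans (parity-with-adj (λ ℓ∈ → proj₂ (∈-without⁻ (set-⊆ X ℓ∈)) refl) (adj-sym G ℓ~p))
              (trans (cong _⁻¹ (trans (parities X (∈-without⁺ v∈S v≢ℓ) v∉X) (toggle-at p t)))
                     (Parity.⁻¹-involutive (t p)))
        ... | no v≢p = trans (cong parity (nbrs-with-nonadj λ a → v≢p (only v∈S (adj-sym G a))))
              (trans (parities X (∈-without⁺ v∈S v≢ℓ) v∉X) (toggle-off t v≢p))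

      -- Removing p as well keeps p out of the set, so that ℓ can join or not as
      -- the parity at p demands.
      stepEven : t ℓ ≡ 0ℙ → ParitySet (S without ℓ without p) t → ParitySet S t
      stepEven tℓ X with parity (# (nbr? p (set X))) Parity.≟ t p
      ... | yes eq = record
        { set = set X
        ; set-⊆ = ⊆S
        ; independent = independent X
        ; parities = par
        }
        where
        ⊆S : set X ⊆ S
        ⊆S = proj₁ ∘ ∈-without⁻ ∘ proj₁ ∘ ∈-without⁻ ∘ set-⊆ X
        par : ∀ {v} → v ∈ S → v ∉ set X → parity (# (nbr? v (set X))) ≡ t v
        par {v} v∈S v∉X with v ≟ ℓ | v ≟ p
        -- The only neighbour of `ℓ` in `S` is `p`, which is not in the set, so the count at `ℓ` is
        -- zero.
        ... | yes refl | _ = trans (cong parity (#-none (nbr? v (set X))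
                               λ (a , u∈) → proj₂ (∈-without⁻ (set-⊆ X u∈)) (only (⊆S u∈) a))) (sym tℓ)
        ... | no _ | yes refl = eq
        ... | no v≢ℓ | no v≢p = parities X (∈-without⁺ (∈-without⁺ v∈S v≢ℓ) v≢p) v∉X
      ... | no ne = addLeaf X t (proj₁ ∘ ∈-without⁻ ∘ proj₁ ∘ ∈-without⁻)
        (λ ℓ∈ → proj₂ (∈-without⁻ (proj₁ (∈-without⁻ ℓ∈))) refl)
        (λ u∈ a → proj₂ (∈-without⁻ (set-⊆ X u∈)) (only (⊆S u∈) a)) par
        where
        ⊆S : set X ⊆ S
        ⊆S = proj₁ ∘ ∈-without⁻ ∘ proj₁ ∘ ∈-without⁻ ∘ set-⊆ X
        flip : ∀ a b → a ≢ b → a ⁻¹ ≡ b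
        flip 0ℙ 0ℙ ne = contradiction refl ne
        flip 0ℙ 1ℙ ne = refl
        flip 1ℙ 0ℙ ne = refl
        flip 1ℙ 1ℙ ne = contradiction refl ne
        par : ∀ {v} → v ∈ S → v ∉ set X → v ≢ ℓ → parity (# (nbr? v (set X adjoin ℓ))) ≡ t v
        par {v} v∈S v∉X v≢ℓ with v ≟ p
        ... | yes refl = trans (parity-with-adj
                (λ ℓ∈ → proj₂ (∈-without⁻ (proj₁ (∈-without⁻ (set-⊆ X ℓ∈)))) refl) (adj-sym G ℓ~p))
                (flip _ _ ne)
        ... | no v≢p = trans (cong parity (nbrs-with-nonadj λ a → v≢p (only v∈S (adj-sym G a))))
              (parities X (∈-without⁺ (∈-without⁺ v∈S v≢ℓ) v≢p) v∉X)

  -- Without a triangle minor, a nonempty `S` has a leaf. The parity demanded at the leaf decides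
  -- whether it is removed alone or together with its neighbour.
  paritySet : ∀ S → Acc _⊂_ S → ¬ CliqueModel G S 3 → ∀ t → ParitySet S t
  paritySet S (acc rs) free t with nonempty? S
  ... | no empty = record
    { set = ⊥ ; set-⊆ = ⊥-elim ∘ ∉⊥ ; independent = λ u∈ _ _ → ∉⊥ u∈
    ; parities = λ v∈S _ → contradiction (_ , v∈S) empty }
  ... | yes (_ , r∈S) with leaf free r∈S
  ...   | ℓ , ℓ∈S , isolated iso =
    stepIsolated ℓ∈S iso (paritySet _ (rs (without-⊂ ℓ∈S)) (free ∘ model-⊆ (proj₁ ∘ ∈-without⁻)) t)
  ...   | ℓ , ℓ∈S , pendant {p} p∈S ℓ~p only with t ℓ in tℓ
  ...     | 1ℙ = stepOdd ℓ∈S p∈S ℓ~p only tℓ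
              (paritySet _ (rs (without-⊂ ℓ∈S)) (free ∘ model-⊆ (proj₁ ∘ ∈-without⁻)) (toggle p t))
  ...     | 0ℙ = stepEven ℓ∈S p∈S ℓ~p only tℓ
              (paritySet _ (rs (⊆S , ℓ , ℓ∈S , λ ℓ∈ → proj₂ (∈-without⁻ (proj₁ (∈-without⁻ ℓ∈))) refl))
                (free ∘ model-⊆ ⊆S) t)
    where
    ⊆S : S without ℓ without p ⊆ S
    ⊆S = proj₁ ∘ ∈-without⁻ ∘ proj₁ ∘ ∈-without⁻

-- Packings of closed neighbourhoods.

module _ {n : ℕ} (G : Graph n) where

  -- Centres at pairwise distance at least 3 in S, and the union of their closed
  -- neighbourhoods in S.
  record Packing (S : Subset n) (r : Fin n) : Set where
    field
      centres ball : Subset n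
      ball-⊆       : ball ⊆ S
      centres-⊆    : centres ⊆ ball
      conn         : ConnectedFrom G r ball
      centre-nbrs  : ∀ {x v} → x ∈ centres → v ∈ S → Adj G x v → v ∈ ball × v ∉ centres
      unique       : ∀ {v} → v ∈ ball → v ∉ centres →
                     ∃[ x ] (x ∈ centres × Adj G v x × (∀ {y} → y ∈ centres → Adj G v y → y ≡ x))

    Near : Fin n → Set
    Near v = v ∈ ball ⊎ ∃[ f ] (f ∈ ball × Adj G f v)

    near? : Decidable Near
    near? v = v ∈? ball ⊎-dec any? (λ f → f ∈? ball ×-dec adj? G f v)

  open Packing

  closedNbr? : ∀ S r → Decidable (λ v → v ≡ r ⊎ v ∈ S × Adj G r v)
  closedNbr? S r v = v ≟ r ⊎-dec (v ∈? S ×-dec adj? G r v)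

  singlePacking : ∀ {S r} → r ∈ S → Packing S r
  singlePacking {S} {r} r∈S = record
    { centres = ⁅ r ⁆
    ; ball = subset N?
    ; ball-⊆ = λ v∈ → [ (λ { refl → r∈S }) , proj₁ ]′ (∈-subset⁻ N? v∈)
    ; centres-⊆ = λ v∈ → ∈-subset⁺ N? (inj₁ (x∈⁅y⁆⇒x≡y r v∈))
    ; conn = record { root-∈ = r∈B ; reach = λ v∈ → reach′ v∈ (∈-subset⁻ N? v∈) }
    ; centre-nbrs = λ x∈ v∈S x~v → centre (x∈⁅y⁆⇒x≡y r x∈) v∈S x~v
    ; unique = λ v∈ v∉ → r , x∈⁅x⁆ r
        , [ (λ { refl → contradiction (x∈⁅x⁆ r) v∉ }) , adj-sym G ∘ proj₂ ]′ (∈-subset⁻ N? v∈)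
        , λ y∈ _ → x∈⁅y⁆⇒x≡y r y∈
    }
    where
    N? = closedNbr? S r
    r∈B : r ∈ subset N?
    r∈B = ∈-subset⁺ N? (inj₁ refl)
    reach′ : ∀ {v} → v ∈ subset N? → v ≡ r ⊎ v ∈ S × Adj G r v → Star (Inside G (subset N?)) r v
    reach′ v∈ (inj₁ refl) = ε
    reach′ v∈ (inj₂ (_ , r~v)) = (r~v , r∈B , v∈) ◅ ε
    centre : ∀ {x v} → x ≡ r → v ∈ S → Adj G x v → v ∈ subset N? × v ∉ ⁅ r ⁆
    centre refl v∈S r~v = ∈-subset⁺ N? (inj₂ (v∈S , r~v)) , edge⇒≢ G r~v ∘ x∈⁅y⁆⇒x≡y r

  module _ {S : Subset n} {r : Fin n} (P : Packing S r) where

    private B = ball P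

    module _ {u v f : Fin n} (u∈S : u ∈ S) (u-far : ¬ Near P u)
             (v∈S : v ∈ S) (u~v : Adj G u v) (f∈B : f ∈ B) (f~v : Adj G f v) where
      private
        N? : Decidable (λ w → w ∈ B ⊎ (w ≡ u ⊎ w ∈ S × Adj G u w))
        N? w = w ∈? B ⊎-dec closedNbr? S u w
        B′ X′ : Subset n
        B′ = subset N?
        X′ = centres P adjoin u
        old : ∀ {w} → w ∈ B → w ∈ B′
        old = ∈-subset⁺ N? ∘ inj₁
        nbr : ∀ {w} → w ∈ S → Adj G u w → w ∈ B′
        nbr w∈S u~w = ∈-subset⁺ N? (inj₂ (inj₂ (w∈S , u~w)))
        u∈B′ : u ∈ B′
        u∈B′ = ∈-subset⁺ N? (inj₂ (inj₁ refl))
        u-nonadj : ∀ {w} → w ∈ B → ¬ Adj G u w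
        u-nonadj w∈B u~w = u-far (inj₂ (_ , w∈B , adj-sym G u~w))
        to-u : Star (Inside G B′) r u
        to-u = Star.map (λ (a , x∈ , y∈) → a , old x∈ , old y∈) (reach (conn P) f∈B)
               ◅◅ (f~v , old f∈B , nbr v∈S u~v) ◅ (adj-sym G u~v , nbr v∈S u~v , u∈B′) ◅ ε

      -- Since `u` is not near the ball, its closed neighbourhood is disjoint from the ball, and the
      -- edges from `f` to `v` and from `v` to `u` keep the union connected.
      growPacking : Packing S r
      growPacking = record
        { centres = X′
        ; ball = B′
        ; ball-⊆ = λ w∈ → [ ball-⊆ P , [ (λ { refl → u∈S }) , proj₁ ]′ ]′ (∈-subset⁻ N? w∈)
        ; centres-⊆ = λ w∈ → [ old ∘ centres-⊆ P , (λ { refl → u∈B′ }) ]′ (∈-adjoin⁻ w∈)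
        ; conn = record
          { root-∈ = old (root-∈ (conn P))
          ; reach = λ w∈ → reach′ w∈ (∈-subset⁻ N? w∈) }
        ; centre-nbrs = λ x∈ w∈S x~w → centre (∈-adjoin⁻ x∈) w∈S x~w
        ; unique = λ w∈ w∉ → uniq (∈-subset⁻ N? w∈) (w∉ ∘ ∈-adjoin⁺)
        }
        where
        reach′ : ∀ {w} → w ∈ B′ → w ∈ B ⊎ (w ≡ u ⊎ w ∈ S × Adj G u w) → Star (Inside G B′) r w
        reach′ _ (inj₁ w∈B) = Star.map (λ (a , x∈ , y∈) → a , old x∈ , old y∈) (reach (conn P) w∈B)
        reach′ _ (inj₂ (inj₁ refl)) = to-u
        reach′ w∈ (inj₂ (inj₂ (_ , u~w))) = to-u ◅◅ (u~w , u∈B′ , w∈) ◅ ε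
        centre : ∀ {x w} → x ∈ centres P ⊎ x ≡ u → w ∈ S → Adj G x w → w ∈ B′ × w ∉ X′
        centre (inj₁ x∈) w∈S x~w = let w∈B , w∉X = centre-nbrs P x∈ w∈S x~w in
          old w∈B , λ w∈ → [ w∉X , (λ { refl → u-far (inj₁ w∈B) }) ]′ (∈-adjoin⁻ w∈)
        centre (inj₂ refl) w∈S u~w = nbr w∈S u~w
          , λ w∈ → [ (λ w∈X → u-nonadj (centres-⊆ P w∈X) u~w) , edge⇒≢ G u~w ]′ (∈-adjoin⁻ w∈)
        uniq : ∀ {w} → w ∈ B ⊎ (w ≡ u ⊎ w ∈ S × Adj G u w) → ¬ (w ∈ centres P ⊎ w ≡ u) →
               ∃[ x ] (x ∈ X′ × Adj G w x × (∀ {y} → y ∈ X′ → Adj G w y → y ≡ x))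
        uniq (inj₁ w∈B) w∉ = let x , x∈ , w~x , only = unique P w∈B (w∉ ∘ inj₁) in
          x , ∈-adjoin⁺ (inj₁ x∈) , w~x , λ y∈ w~y →
            [ (λ y∈X → only y∈X w~y)
            , (λ { refl → contradiction (adj-sym G w~y) (u-nonadj w∈B) }) ]′ (∈-adjoin⁻ y∈)
        uniq (inj₂ (inj₁ refl)) w∉ = contradiction (inj₂ refl) w∉
        uniq (inj₂ (inj₂ (w∈S , u~w))) w∉ =
          -- A neighbour of an old centre lies in the old ball, and no vertex of that ball is
          -- adjacent to `u`; so `w` sees no old centre.
          u , ∈-adjoin⁺ (inj₂ refl) , adj-sym G u~w , λ y∈ w~y →
            [ (λ y∈X → contradiction u~w (u-nonadj (proj₁ (centre-nbrs P y∈X w∈S (adj-sym G w~y)))))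
            , (λ y≡u → y≡u) ]′ (∈-adjoin⁻ y∈)

      growPacking-⊃ : B ⊂ ball growPacking
      growPacking-⊃ = old , u , u∈B′ , u-far ∘ inj₁

    -- Says that no edge of `S` leaves the vertices near the ball. As the ball is connected, these
    -- vertices of `S` form the whole component of `r`.
    Closed : Set
    Closed = ∀ {u v} → u ∈ S → v ∈ S → Adj G u v → Near P v → Near P u

  -- A failure of closedness supplies exactly the vertices `u`, `v`, `f` needed to grow the packing,
  -- and the ball cannot grow forever.
  closedPacking : ∀ {S r} (P : Packing S r) → Acc _⊃_ (ball P) → ∃[ Q ] Closed {S} {r} Q
  closedPacking {S} P (acc rs)
    with any? (λ u → u ∈? S ×-dec ¬? (near? P u) ×-dec any? λ v → v ∈? S ×-dec adj? G u v
                ×-dec any? λ f → f ∈? ball P ×-dec adj? G f v)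
  ... | yes (u , u∈S , far , v , v∈S , u~v , f , f∈B , f~v) =
    closedPacking (growPacking P u∈S far v∈S u~v f∈B f~v)
                  (rs (growPacking-⊃ P u∈S far v∈S u~v f∈B f~v))
  ... | no none = P , closed
    where
    closed : Closed P
    closed {u} {v} u∈S v∈S u~v (inj₁ v∈B) = inj₂ (v , v∈B , adj-sym G u~v)
    closed {u} {v} u∈S v∈S u~v (inj₂ (f , f∈B , f~v)) = decidable-stable (near? P u) λ far →
      none (u , u∈S , far , v , v∈S , u~v , f , f∈B , f~v)

  -- Partial odd colourings by induction on the clique order.

  colourNbr? : ∀ {m} (g : Fin n → Maybe (Fin m)) v i →
               Decidable (λ u → Adj G v u × g u ≡ just i)
  colourNbr? g v i u = adj? G v u ×-dec ≡-dec _≟_ (g u) (just i)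

  -- The set X of the coloured vertices; vertices outside S are not coloured.
  record PartialOdd (S : Subset n) (m : ℕ) : Set where
    field
      colour   : Fin n → Maybe (Fin m)
      colour-∈ : ∀ {v i} → colour v ≡ just i → v ∈ S
      indep    : ∀ {u v i j} → colour u ≡ just i → colour v ≡ just j → ¬ Adj G u v
      odd      : ∀ {v} → v ∈ S → colour v ≡ nothing → ∃[ i ] Odd (# (colourNbr? colour v i))

  open PartialOdd

  fromParitySet : ∀ {S} → ParitySet G S (λ _ → 1ℙ) → PartialOdd S 1
  fromParitySet {S} X = record
    { colour = col
    ; colour-∈ = λ eq → set-⊆ (col⁻ eq)
    ; indep = λ lu lv → independent (col⁻ lu) (col⁻ lv)
    ; odd = λ {v} v∈S eq → zero , trans
        (cong parity (#-cong (colourNbr? col v zero) (nbr? G v set)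
          ((λ (a , eq) → a , col⁻ eq) , (λ (a , u∈) → a , col⁺ u∈))))
        (parities v∈S λ v∈ → just≢nothing (trans (sym (col⁺ v∈)) eq))
    }
    where
    open ParitySet X
    just≢nothing : ∀ {A : Set} {x : A} → just x ≢ nothing
    just≢nothing ()
    col : Fin n → Maybe (Fin 1)
    col v with v ∈? set
    ... | yes _ = just zero
    ... | no  _ = nothing
    col⁻ : ∀ {v i} → col v ≡ just i → v ∈ set
    col⁻ {v} eq with v ∈? set | eq
    ... | yes v∈ | _ = v∈
    col⁺ : ∀ {v} → v ∈ set → col v ≡ just zero
    col⁺ {v} v∈ with v ∈? set
    ... | yes _ = refl
    ... | no v∉ = contradiction v∈ v∉

  module _ {S : Subset n} {r : Fin n} (P : Packing S r) where

    -- The rest of the component of `r` once the packing is closed, described so as to match the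
    -- domination hypothesis of `extendModel`.
    fringe? : Decidable (λ v → v ∈ S × v ∉ ball P × ∃[ f ] (f ∈ ball P × Adj G f v))
    fringe? v = v ∈? S ×-dec ¬? (v ∈? ball P) ×-dec any? λ f → f ∈? ball P ×-dec adj? G f v

    far? : Decidable (λ v → v ∈ S × ¬ Near P v)
    far? v = v ∈? S ×-dec ¬? (near? P v)

    module _ {m : ℕ} (closed : Closed P) (R : PartialOdd (subset fringe?) m)
             (Q : PartialOdd (subset far?) (suc m)) where
      private
        -- The colour is an index, so that matching on `place v` also reveals it. Fringe colours are
        -- shifted to reserve zero for the centres; vertices beyond may reuse every colour, as they
        -- lie in other components.
        data Place (v : Fin n) : Maybe (Fin (suc m)) → Set where
          centre : v ∈ centres P → Place v (just zero)
          shell  : v ∈ ball P → v ∉ centres P → Place v nothing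
          fringe : v ∈ subset fringe? → Place v (Maybe.map suc (colour R v))
          beyond : ¬ Near P v → Place v (colour Q v)
          outer  : v ∉ S → Place v nothing

        place : ∀ v → ∃[ c ] Place v c
        place v with v ∈? centres P
        ... | yes v∈X = _ , centre v∈X
        ... | no v∉X with v ∈? ball P
        ...   | yes v∈B = _ , shell v∈B v∉X
        ...   | no v∉B with v ∈? S
        ...     | no v∉S = _ , outer v∉S
        ...     | yes v∈S with v ∈? subset fringe?
        ...       | yes v∈R = _ , fringe v∈R
        ...       | no v∉R = _ , beyond
                    [ v∉B , (λ d → v∉R (∈-subset⁺ fringe? (v∈S , v∉B , d))) ]′

        col : Fin n → Maybe (Fin (suc m))
        col = proj₁ ∘ place

        fringe-near : ∀ {v} → v ∈ subset fringe? → Near P v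
        fringe-near = inj₂ ∘ proj₂ ∘ proj₂ ∘ ∈-subset⁻ fringe?

        fringe-∈ : ∀ {v} → v ∈ subset fringe? → v ∈ S
        fringe-∈ = proj₁ ∘ ∈-subset⁻ fringe?

        fringe-∉ : ∀ {v} → v ∈ subset fringe? → v ∉ ball P
        fringe-∉ = proj₁ ∘ proj₂ ∘ ∈-subset⁻ fringe?

        centre-∈ : ∀ {v} → v ∈ centres P → v ∈ S
        centre-∈ = ball-⊆ P ∘ centres-⊆ P

        far-∈ : ∀ {v i} → colour Q v ≡ just i → v ∈ S
        far-∈ eq = proj₁ (∈-subset⁻ far? (colour-∈ Q eq))

        far-¬near : ∀ {v i} → colour Q v ≡ just i → ¬ Near P v
        far-¬near eq = proj₂ (∈-subset⁻ far? (colour-∈ Q eq))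

        data Coloured (v : Fin n) : Fin (suc m) → Set where
          centre : v ∈ centres P → Coloured v zero
          fringe : ∀ {i} → v ∈ subset fringe? → colour R v ≡ just i → Coloured v (suc i)
          beyond : ∀ {i} → colour Q v ≡ just i → Coloured v i

        coloured : ∀ {v i} → col v ≡ just i → Coloured v i
        coloured {v} eq with place v
        coloured refl | _ , centre v∈X = centre v∈X
        coloured {v} eq | _ , fringe v∈R with colour R v in eq′
        coloured refl | _ , fringe v∈R | just i = fringe v∈R eq′
        coloured eq | _ , beyond _ = beyond eq

        near-∉Q : ∀ {v i} → Near P v → colour Q v ≢ just i
        near-∉Q near eq = far-¬near eq near

        col-centre : ∀ {v} → v ∈ centres P → col v ≡ just zero
        col-centre {v} v∈X with place v
        ... | _ , centre _ = refl
        ... | _ , shell _ v∉X = contradiction v∈X v∉X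
        ... | _ , fringe v∈R = contradiction (centres-⊆ P v∈X) (fringe-∉ v∈R)
        ... | _ , beyond far = contradiction (inj₁ (centres-⊆ P v∈X)) far
        ... | _ , outer v∉S = contradiction (centre-∈ v∈X) v∉S

        col-fringe : ∀ {v} → v ∈ subset fringe? → col v ≡ Maybe.map suc (colour R v)
        col-fringe {v} v∈R with place v
        ... | _ , centre v∈X = contradiction (centres-⊆ P v∈X) (fringe-∉ v∈R)
        ... | _ , shell v∈B _ = contradiction v∈B (fringe-∉ v∈R)
        ... | _ , fringe _ = refl
        ... | _ , beyond far = contradiction (fringe-near v∈R) far
        ... | _ , outer v∉S = contradiction (fringe-∈ v∈R) v∉S

        col-beyond : ∀ {v i} → colour Q v ≡ just i → col v ≡ just i
        col-beyond {v} eq with place v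
        ... | _ , centre v∈X = contradiction (inj₁ (centres-⊆ P v∈X)) (far-¬near eq)
        ... | _ , shell v∈B _ = contradiction (inj₁ v∈B) (far-¬near eq)
        ... | _ , fringe v∈R = contradiction (fringe-near v∈R) (far-¬near eq)
        ... | _ , beyond _ = eq
        ... | _ , outer v∉S = contradiction (far-∈ eq) v∉S

        -- Neighbours of a centre in `S` are uncoloured vertices of the ball, and closedness
        -- separates the fringe from what lies beyond.
        indep′ : ∀ {u v i j} → Coloured u i → Coloured v j → ¬ Adj G u v
        indep′ (centre u∈) (centre v∈) a = proj₂ (centre-nbrs P u∈ (centre-∈ v∈) a) v∈
        indep′ (centre u∈) (fringe v∈ _) a = fringe-∉ v∈ (proj₁ (centre-nbrs P u∈ (fringe-∈ v∈) a))
        indep′ (centre u∈) (beyond lv) a =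
          far-¬near lv (inj₁ (proj₁ (centre-nbrs P u∈ (far-∈ lv) a)))
        indep′ (fringe u∈ _) (centre v∈) a =
          fringe-∉ u∈ (proj₁ (centre-nbrs P v∈ (fringe-∈ u∈) (adj-sym G a)))
        indep′ (fringe _ lu) (fringe _ lv) a = indep R lu lv a
        indep′ (fringe u∈ _) (beyond lv) a =
          far-¬near lv (closed (far-∈ lv) (fringe-∈ u∈) (adj-sym G a) (fringe-near u∈))
        indep′ (beyond lu) (centre v∈) a =
          far-¬near lu (inj₁ (proj₁ (centre-nbrs P v∈ (far-∈ lu) (adj-sym G a))))
        indep′ (beyond lu) (fringe v∈ _) a =
          far-¬near lu (closed (far-∈ lu) (fringe-∈ v∈) a (fringe-near v∈))
        indep′ (beyond lu) (beyond lv) a = indep Q lu lv a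

        -- A vertex of the shell sees colour zero once, at its unique centre. Elsewhere the odd
        -- colour given by `R` or `Q` survives, since no other part contributes to that colour.
        odd′ : ∀ {v} → v ∈ S → col v ≡ nothing → ∃[ i ] Odd (# (colourNbr? col v i))
        odd′ {v} v∈S eq with place v
        odd′ v∈S eq | _ , outer v∉S = contradiction v∈S v∉S
        odd′ {v} v∈S _ | _ , shell v∈B v∉X = zero , cong parity
            (#-unique (colourNbr? col v zero) (v~x , col-centre x∈) (λ (a , lu) → only′ a (coloured lu)))
          where
          x    = proj₁ (unique P v∈B v∉X)
          x∈   = proj₁ (proj₂ (unique P v∈B v∉X))
          v~x  = proj₁ (proj₂ (proj₂ (unique P v∈B v∉X)))
          only = proj₂ (proj₂ (proj₂ (unique P v∈B v∉X)))
          only′ : ∀ {u} → Adj G v u → Coloured u zero → u ≡ x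
          only′ a (centre u∈) = only u∈ a
          only′ a (beyond lu) =
            contradiction (closed (far-∈ lu) v∈S (adj-sym G a) (inj₁ v∈B)) (far-¬near lu)
        odd′ {v} v∈S eq | _ , fringe v∈R with colour R v in eq′
        ... | nothing = let i , o = odd R v∈R eq′ in
          suc i , trans (cong parity (#-cong (colourNbr? col v (suc i)) (colourNbr? (colour R) v i)
            ( (λ (a , lu) → a , to a (coloured lu))
            , (λ (a , lu) → a , trans (col-fringe (colour-∈ R lu)) (cong (Maybe.map suc) lu))))) o
          where
          to : ∀ {u i} → Adj G v u → Coloured u (suc i) → colour R u ≡ just i
          to a (fringe _ lu) = lu
          to a (beyond lu) =
            contradiction (closed (far-∈ lu) v∈S (adj-sym G a) (fringe-near v∈R)) (far-¬near lu)
        odd′ {v} v∈S eq | _ , beyond far = let i , o = odd Q (∈-subset⁺ far? (v∈S , far)) eq in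
          i , trans (cong parity (#-cong (colourNbr? col v i) (colourNbr? (colour Q) v i)
            ((λ (a , lu) → a , to a (coloured lu)) , (λ (a , lu) → a , col-beyond lu)))) o
          where
          to : ∀ {u i} → Adj G v u → Coloured u i → colour Q u ≡ just i
          to a (centre u∈) = contradiction (inj₁ (proj₁ (centre-nbrs P u∈ v∈S (adj-sym G a)))) far
          to a (fringe u∈ _) = contradiction (closed v∈S (fringe-∈ u∈) a (fringe-near u∈)) far
          to a (beyond lu) = lu

      combine : PartialOdd S (suc m)
      combine = record
        { colour = col
        ; colour-∈ = λ eq → col-∈ (coloured eq)
        ; indep = λ lu lv → indep′ (coloured lu) (coloured lv)
        ; odd = odd′
        }
        where
        col-∈ : ∀ {v i} → Coloured v i → v ∈ S
        col-∈ (centre v∈) = centre-∈ v∈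
        col-∈ (fringe v∈ _) = fringe-∈ v∈
        col-∈ (beyond lv) = far-∈ lv

  emptyPartialOdd : ∀ {S m} → (∀ {v} → v ∉ S) → PartialOdd S m
  emptyPartialOdd empty = record
    { colour = λ _ → nothing ; colour-∈ = λ () ; indep = λ ()
    ; odd = λ v∈ → contradiction v∈ empty }

  -- The outer induction lowers the clique order and handles the fringe; the inner one, on `S`, runs
  -- through the components.
  partialOdd : ∀ m S → ¬ CliqueModel G S (3 + m) → PartialOdd S (suc m)
  partialOdd zero S free = fromParitySet (paritySet G S (⊂-wellFounded S) free (λ _ → 1ℙ))
  partialOdd (suc m) S free = components S (⊂-wellFounded S) free
    where
    components : ∀ S → Acc _⊂_ S → ¬ CliqueModel G S (4 + m) → PartialOdd S (2 + m)
    components S (acc rs) free with nonempty? S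
    ... | no empty = emptyPartialOdd λ v∈ → empty (_ , v∈)
    ... | yes (r , r∈S) =
      combine P closed
        -- The ball serves as one more branch set for a clique model in the fringe.
        (partialOdd m _ λ M → free (extendModel G (conn P) (ball-⊆ P)
          (proj₁ ∘ ∈-subset⁻ (fringe? P)) (proj₂ ∘ ∈-subset⁻ (fringe? P)) M))
        (components _ (rs smaller) (free ∘ model-⊆ far-⊆))
      where
      grown = closedPacking (singlePacking r∈S) (⊃-wellFounded _)
      P = proj₁ grown
      closed = proj₂ grown
      far-⊆ : subset (far? P) ⊆ S
      far-⊆ = proj₁ ∘ ∈-subset⁻ (far? P)
      smaller : subset (far? P) ⊂ S
      smaller = far-⊆ , r , r∈S , λ r∈ → proj₂ (∈-subset⁻ (far? P) r∈) (inj₁ (root-∈ (conn P)))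

-- Colouring a contraction, and the final bound.

open PartialOdd


-- The classes of μ need not be connected: only edges inside them are contracted.
contractColoring : ∀ {k} → (∀ {n} (H : Graph n) → K (suc k) MinorFree H → Colorable H k) →
  ∀ {n N} (G : Graph n) → K (suc k) MinorFree G → (μ : Fin n → Fin N) →
  ∃[ c ] (∀ {u v} → Adj G u v → (μ u ≡ μ v → c u ≡ c v) × (μ u ≢ μ v → c u ≢ c v))
contractColoring {k} colorable {n} G free μ
  with any? (λ u → any? λ v → adj? G u v ×-dec μ u ≟ μ v)
contractColoring {k} colorable {zero} G free μ | yes (() , _)
contractColoring {k} colorable {suc n} G free μ | yes (u , v , u~v , μu≡μv) =
  let v≢u = edge⇒≢ G u~v
      π = merge v≢u
      μπ = label-merge v≢u μ μu≡μv
      c , c-ok = contractColoring colorable (contract G u~v) (free ∘ contr u~v) (μ ∘ punchIn v)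
      π-adj : ∀ {x y} → Adj G x y → π x ≢ π y → Adj (contract G u~v) (π x) (π y)
      π-adj x~y ne = ne , _ , _ , refl , refl , x~y
      same : ∀ {x y} → Adj G x y → μ x ≡ μ y → c (π x) ≡ c (π y)
      same {x} {y} x~y eq = case π x ≟ π y of λ where
        -- Either the edge was just contracted, or it survives inside a class of the contraction and
        -- is treated by the recursive call.
        (yes πx≡πy) → cong c πx≡πy
        (no πx≢πy) → proj₁ (c-ok (π-adj x~y πx≢πy)) (trans (μπ x) (trans eq (sym (μπ y))))
      diff : ∀ {x y} → Adj G x y → μ x ≢ μ y → c (π x) ≢ c (π y)
      diff {x} {y} x~y ne =
        let μ-ne : μ (punchIn v (π x)) ≢ μ (punchIn v (π y))
            μ-ne eq = ne (trans (sym (μπ x)) (trans eq (μπ y))) in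
        proj₂ (c-ok (π-adj x~y (μ-ne ∘ cong (μ ∘ punchIn v)))) μ-ne
  in c ∘ π , λ x~y → same x~y , diff x~y
... | no none = let c , proper = colorable G free in
      c , λ u~v → (λ eq → contradiction (_ , _ , u~v , eq) none) , λ _ → proper _ _ u~v

oddColorable : ∀ m → (∀ {n} (H : Graph n) → K (3 + m) MinorFree H → Colorable H (2 + m)) →
               ∀ {n} (G : Graph n) → K (3 + m) MinorFree G → OddColorable G (suc m + (2 + m))
oddColorable m colorable {n} G free = f , proper , odd-f
  where
  X : PartialOdd G ⊤ (suc m)
  X = partialOdd G m ⊤ (free ∘ model⇒minor G)

  g = colour X

  -- The contraction, given by its fibres. A non-isolated vertex of `X` moves to a neighbour, which
  -- is uncoloured by independence and hence fixed; so edges inside a fibre join vertices of `X` to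
  -- their partners.
  partner : Fin n → Fin n
  partner v with g v | any? (adj? G v)
  ... | just _ | yes (u , _) = u
  ... | _      | _           = v

  partner-nothing : ∀ {v} → g v ≡ nothing → partner v ≡ v
  partner-nothing {v} eq with g v | any? (adj? G v)
  ... | nothing | _ = refl

  partner-adj : ∀ {v i} → g v ≡ just i → NonIsolated G v → Adj G v (partner v)
  partner-adj {v} eq nonIso with g v | any? (adj? G v)
  ... | just _ | yes (_ , v~u) = v~u
  ... | just _ | no none = contradiction nonIso none

  contracted = contractColoring colorable G free partner
  c = proj₁ contracted

  -- Keeps the palette of `X` apart from that of the contraction, so the two numbers of colours add
  -- up.
  tag : Maybe (Fin (suc m)) → Fin (2 + m) → Fin (suc m) ⊎ Fin (2 + m)
  tag (just i) _ = inj₁ i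
  tag nothing  b = inj₂ b

  tag-inj₁ : ∀ {x b i} → tag x b ≡ inj₁ i → x ≡ just i
  tag-inj₁ {just _} refl = refl

  tag-inj₂ : ∀ {x b b′} → tag x b ≡ inj₂ b′ → x ≡ nothing × b ≡ b′
  tag-inj₂ {nothing} refl = refl , refl

  f : Fin n → Fin (suc m + (2 + m))
  f v = join (suc m) (2 + m) (tag (g v) (c v))

  f-tag : ∀ {v s} → f v ≡ join (suc m) (2 + m) s → tag (g v) (c v) ≡ s
  f-tag {v} {s} eq = trans (sym (splitAt-join (suc m) (2 + m) _))
                       (trans (cong (splitAt (suc m)) eq) (splitAt-join (suc m) (2 + m) s))

  partner-≢ : ∀ {u v} → g u ≡ nothing → g v ≡ nothing → Adj G u v → partner u ≢ partner v
  partner-≢ gu gv u~v eq =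
    edge⇒≢ G u~v (sym (trans (sym (partner-nothing gu)) (trans eq (partner-nothing gv))))

  proper : Proper G f
  proper u v u~v fu≡fv with g v in gv
  ... | just j with f-tag {s = inj₁ j} fu≡fv
  ...   | eq = indep X (tag-inj₁ eq) gv u~v
  proper u v u~v fu≡fv | nothing with tag-inj₂ {g u} (f-tag {s = inj₂ (c v)} fu≡fv)
  -- Uncoloured vertices are fixed by `partner`, so adjacent ones lie in different fibres and `c`
  -- separates them.
  ...   | gu , cu≡cv = proj₂ (proj₂ contracted u~v) (partner-≢ gu gv u~v) cu≡cv

  odd-f : ∀ v → NonIsolated G v → ∃[ i ] Odd (occurrences G f v i)
  odd-f v nonIso with g v in gv
  ... | nothing = let i , o = odd X ∈⊤ gv in
    join (suc m) (2 + m) (inj₁ i) ,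
    trans (cong parity (#-cong (λ u → adj? G v u ×-dec f u ≟ _) (colourNbr? G g v i)
      ( (λ {u} (a , eq) → a , tag-inj₁ (f-tag {u} {inj₁ i} eq))
      , (λ {u} (a , eq) → a , cong (λ x → join (suc m) (2 + m) (tag x (c u))) eq)))) o
  ... | just i = f w , cong parity (#-unique (λ u → adj? G v u ×-dec f u ≟ f w) (v~w , refl) only)
    where
    w = partner v
    v~w : Adj G v w
    v~w = partner-adj gv nonIso
    nbr-nothing : ∀ {u} → Adj G v u → g u ≡ nothing
    nbr-nothing {u} v~u with g u in gu
    ... | nothing = refl
    ... | just _ = contradiction v~u (indep X gv gu)
    fw : f w ≡ join (suc m) (2 + m) (inj₂ (c w))
    fw = cong (λ x → join (suc m) (2 + m) (tag x (c w))) (nbr-nothing v~w)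
    cv≡cw : c v ≡ c w
    cv≡cw = proj₁ (proj₂ contracted v~w) (sym (partner-nothing (nbr-nothing v~w)))
    only : ∀ {u} → Adj G v u × f u ≡ f w → u ≡ w
    -- Another neighbour `u` of `v` is uncoloured and fixed by `partner`, hence outside the fibre of
    -- `v`; so `c u` differs from `c v`, which equals `c w`.
    only {u} (v~u , fu≡fw) = decidable-stable (u ≟ w) λ u≢w →
      proj₂ (proj₂ contracted v~u)
        (λ eq → u≢w (sym (trans eq (partner-nothing (nbr-nothing v~u)))))
        (trans cv≡cw (sym (proj₂ (tag-inj₂ {g u} (f-tag {u} {inj₂ (c w)} (trans fu≡fw fw))))))

-- The case of one colour, which lies below the start of the induction: an edge would already be a
-- forbidden minor.
edgeless : ∀ {n} (G : Graph n) → K 2 MinorFree G → OddColorable G 1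
edgeless G free = (λ _ → zero)
  , (λ u v u~v _ → no-edge u~v) , (λ v (u , v~u) → ⊥-elim (no-edge v~u))
  where
  no-edge : ∀ {u v} → ¬ Adj G u v
  no-edge u~v = free (model⇒minor G (edgeModel G ∈⊤ ∈⊤ u~v))

lemma3p6 : (k : ℕ) → k ≥ 1 →
    (∀ {n} (H : Graph n) → K (suc k) MinorFree H → Colorable H k) →
    ∀ {n} (G : Graph n) → K (suc k) MinorFree G → χₒ G ≤ 2 * k ∸ 1
lemma3p6 (suc zero) _ _ G free = proj₂ (proj₂ (χₒ-least G)) _ (edgeless G free)
lemma3p6 (suc (suc m)) _ colorable G free = proj₂ (proj₂ (χₒ-least G)) _
  -- For `k = 2 + m` the bound computes to `suc m + (2 + m + 0)`.
  (subst (λ j → OddColorable G (suc m + j)) (sym (+-identityʳ (2 + m)))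
    (oddColorable m colorable G free))
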